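{- Let $k\ge 2$ be an integer. Then for any integer $r\ge 1$, the number of odd positive integers $n$ satisfying $\sigma(n)=kn$ and $\omega(n)\le r$ is at most $k\,4^{r^3}$.
   Context: $\sigma(n)$ denotes the sum of the positive divisors of the positive integer $n$, and $\omega(n)$ denotes the number of distinct prime factors of $n$. A positive integer $n$ with $\sigma(n)=kn$ is called $k$-perfect. -}

module Defs where

open import Data.Nat using (ℕ; suc; _+_; _*_; _%_; _≤_)
open import Data.Nat.Divisibility using (_∣_; _∣?_)
open import Data.Nat.Primality using (prime?)
open import Data.List using (List; filter; length; upTo; map)
open import Data.Nat.ListAction using (sum)
open import Data.Product using (_×_)
open import Relation.Binary.PropositionalEquality using (_≡_)
open import Relation.Nullary.Decidable using (_×-dec_)

divisors : ℕ → List ℕ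
divisors n = filter (_∣? n) (map suc (upTo n))

σ : ℕ → ℕ
σ n = sum (divisors n)

ω : ℕ → ℕ
ω n = length (filter (λ p → prime? p ×-dec (p ∣? n)) (map suc (upTo n)))

Good : ℕ → ℕ → ℕ → Set
Good k r n = (1 ≤ n) × (n % 2 ≡ 1) × (σ n ≡ k * n) × (ω n ≤ r)

module Submission where

open import Defs
open import Data.Nat
open import Data.Nat.Coprimality using (Coprime; coprime-divisor)
open import Data.Nat.Divisibility
open import Data.Nat.GCD using (gcd; gcd[m,n]∣m; gcd[m,n]∣n; gcd-greatest; gcd[m,n]≢0)
open import Data.Nat.Induction using (<-wellFounded)
open import Data.Nat.ListAction using (sum; product)
open import Data.Nat.ListAction.Properties using (product-++; sum-++; sum-↭)
open import Data.Nat.Primality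
open import Data.Nat.Primality.Factorisation using (factorise; factors)
open import Data.Nat.Properties
open import Algebra.Properties.CommutativeSemigroup *-commutativeSemigroup using (interchange; x∙yz≈y∙xz; xy∙z≈xz∙y)
open import Data.Nat.Tactic.RingSolver using (solve-∀)
open import Data.List using (List; []; _∷_; _++_; map; length; filter; upTo; concatMap; replicate)
open import Data.List.Membership.Propositional using (_∈_; find; lose)
open import Data.List.Membership.Propositional.Properties
open import Data.List.Membership.Propositional.Properties.WithK using (unique∧set⇒bag)
open import Data.List.Properties using (map-++; length-++; length-++-≤ˡ; length-map; length-upTo; length-replicate; length-removeAt′)
open import Data.List.Relation.Binary.BagAndSetEquality using (∼bag⇒↭)
open import Data.List.Relation.Binary.Subset.Propositional using (_⊆_)
open import Data.List.Relation.Unary.All as All using (All; []; _∷_)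
import Data.List.Relation.Unary.All.Properties as All
open import Data.List.Relation.Unary.AllPairs as AllPairs using (AllPairs; []; _∷_)
import Data.List.Relation.Unary.AllPairs.Properties as AllPairs
open import Data.List.Relation.Unary.Any as Any using (Any; here; there; _─_; any?)
open import Data.List.Relation.Unary.Unique.Propositional using (Unique)
import Data.List.Relation.Unary.Unique.Propositional.Properties as Unique
open import Data.Product using (_×_; _,_; proj₁; proj₂; ∃; ∃₂)
open import Data.Sum using (_⊎_; inj₁; inj₂; [_,_]′)
open import Function using (_∘_; id; _on_; mk⇔)
open import Induction.WellFounded using (Acc; acc)
open import Relation.Binary.PropositionalEquality
open import Relation.Nullary using (¬_; yes; no; contradiction)
open import Relation.Nullary.Decidable using (_×-dec_)

-- Let n be odd with σ n = k n and ω n ≤ r.  Going up through its primes, let P be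
-- the first initial block with k ∏ (1 − 1/p) ≤ 1.  As the primes are distinct, each
-- one is bounded in terms of the product of the preceding ones, which bounds D = ∏ p.
-- By parity the inequality is strict, hence k ∏ (1 − 1/p) ≤ 1 − 1/D, and this forces
-- some p ^ (e + 1) with p in P to be at most r D.  Splitting off that prime power and
-- iterating (with σ B / B = b / a for the remaining part B) bounds n, and shows that
-- every exponent in n is below X = 2 ^ r².
--
-- To count (Wirsing), write n = A B with A the part made of primes ≤ r.  Then
-- 1 < σ B / B < 2, so σ A / (k A) = B / σ B in lowest terms has numerator > 1, which
-- divides B: a prime of B is determined by A.  Guessing its exponent and repeating,
-- n is determined by at most r + r exponents, leaving X ^ (2 r) = 4 ^ r³ possibilities.

-- The divisor sum in terms of the prime factorisation

∏ : ∀ {A : Set} → (A → ℕ) → List A → ℕ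
∏ f xs = product (map f xs)

-- Horner form of 1 + p + ... + p ^ e, which is σ (p ^ e) when p is prime.
geom : ℕ → ℕ → ℕ
geom p zero    = 1
geom p (suc e) = 1 + p * geom p e

Power : Set
Power = ℕ × ℕ

base power sigma : Power → ℕ
base = proj₁
power (p , e) = p ^ e
sigma (p , e) = geom p e

module _ {A : Set} {f g : A → ℕ} where

  ∏-* : ∀ xs → ∏ (λ x → f x * g x) xs ≡ ∏ f xs * ∏ g xs
  ∏-* []       = refl
  ∏-* (x ∷ xs) rewrite ∏-* xs = interchange (f x) (g x) (∏ f xs) (∏ g xs)

  ∏-mono-≤ : ∀ {xs} → All (λ x → f x ≤ g x) xs → ∏ f xs ≤ ∏ g xs
  ∏-mono-≤ []       = ≤-refl
  ∏-mono-≤ (h ∷ hs) = *-mono-≤ h (∏-mono-≤ hs)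

module _ {A : Set} (f : A → ℕ) where

  ∏-++ : ∀ xs ys → ∏ f (xs ++ ys) ≡ ∏ f xs * ∏ f ys
  ∏-++ xs ys = trans (cong product (map-++ f xs ys)) (product-++ (map f xs) (map f ys))

  ∏-─ : ∀ {x xs} (i : x ∈ xs) → ∏ f xs ≡ f x * ∏ f (xs ─ i)
  ∏-─ (here refl)              = refl
  ∏-─ {x} {y ∷ xs} (there i) rewrite ∏-─ i = x∙yz≈y∙xz (f y) (f x) _

  ∏-positive : ∀ {xs} → All (λ x → 0 < f x) xs → 0 < ∏ f xs
  ∏-positive []       = s≤s z≤n
  ∏-positive (h ∷ hs) = *-mono-≤ h (∏-positive hs)

module _ {n : ℕ} (1≤n : 1 ≤ n) where

  private instance
    n≢0 : NonZero n
    n≢0 = >-nonZero 1≤n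

  ∈-range : ∀ {d} → d ∣ n → d ∈ map suc (upTo n)
  ∈-range {zero}  d∣n = contradiction (subst (1 ≤_) (0∣⇒≡0 d∣n) 1≤n) λ ()
  ∈-range {suc d} d∣n = ∈-map⁺ suc (∈-upTo⁺ (∣⇒≤ d∣n))

  ∈-divisors : ∀ {d} → d ∣ n → d ∈ divisors n
  ∈-divisors d∣n = ∈-filter⁺ (_∣? n) (∈-range d∣n) d∣n

∈-divisors⁻ : ∀ n {d} → d ∈ divisors n → d ∣ n
∈-divisors⁻ n d∈ = proj₂ (∈-filter⁻ (_∣? n) {xs = map suc (upTo n)} d∈)

divisors-unique : ∀ n → Unique (divisors n)
divisors-unique n = Unique.filter⁺ (_∣? n) (Unique.map⁺ suc-injective (Unique.upTo⁺ n))

sum-map-* : ∀ p xs → sum (map (p *_) xs) ≡ p * sum xs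
sum-map-* p []       = sym (*-zeroʳ p)
sum-map-* p (x ∷ xs) rewrite sum-map-* p xs = sym (*-distribˡ-+ p x (sum xs))

module _ {p : ℕ} (p-prime : Prime p) where

  private instance
    p≢0 : NonZero p
    p≢0 = prime⇒nonZero p-prime

  ∤⇒coprime : ∀ {z} → ¬ p ∣ z → Coprime z p
  ∤⇒coprime p∤z (d∣z , d∣p) with prime⇒irreducible p-prime d∣p
  ... | inj₁ d≡1  = d≡1
  ... | inj₂ refl = contradiction d∣z p∤z

  coprime-^-divisor : ∀ {z m} e → Coprime z p → z ∣ p ^ e * m → z ∣ m
  coprime-^-divisor {z} {m} zero    c z∣ = subst (z ∣_) (*-identityˡ m) z∣
  coprime-^-divisor {z} {m} (suc e) c z∣ = coprime-^-divisor e c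
    (coprime-divisor c (subst (z ∣_) (*-assoc p (p ^ e) m) z∣))

  prime∣^⇒≡ : ∀ {q} e → Prime q → q ∣ p ^ e → q ≡ p
  prime∣^⇒≡ {q} zero    q-prime q∣ = contradiction (∣1⇒≡1 q∣) λ { refl → ¬prime[1] q-prime }
  prime∣^⇒≡ {q} (suc e) q-prime q∣ with euclidsLemma p (p ^ e) q-prime q∣
  ... | inj₂ q∣′ = prime∣^⇒≡ e q-prime q∣′
  ... | inj₁ q∣p with prime⇒irreducible p-prime q∣p
  ...   | inj₁ refl = contradiction q-prime ¬prime[1]
  ...   | inj₂ q≡p  = q≡p

  -- The divisors of p ^ suc e * m are those of m (the ones prime to p) and
  -- p times those of p ^ e * m.
  σ-*-prime : ∀ {m} e → 1 ≤ m → ¬ p ∣ m → σ (p * (p ^ e * m)) ≡ σ m + p * σ (p ^ e * m)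
  σ-*-prime {m} e 1≤m p∤m = begin
    -- Both lists are duplicate-free, so equal membership already makes them permutations of each
    -- other.
    sum (divisors (p * M))                           ≡⟨ sum-↭ (∼bag⇒↭ (unique∧set⇒bag (divisors-unique (p * M)) unique (mk⇔ to from))) ⟩
    sum (divisors m ++ map (p *_) (divisors M))      ≡⟨ sum-++ (divisors m) _ ⟩
    σ m + sum (map (p *_) (divisors M))              ≡⟨ cong (σ m +_) (sum-map-* p (divisors M)) ⟩
    σ m + p * σ M                                    ∎
    where
    open ≡-Reasoning
    M = p ^ e * m
    1≤M : 1 ≤ M
    1≤M = *-mono-≤ (m^n>0 p e) 1≤m
    1≤pM : 1 ≤ p * M
    1≤pM = *-mono-≤ (>-nonZero⁻¹ p) 1≤M
    unique : Unique (divisors m ++ map (p *_) (divisors M))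
    unique = Unique.++⁺ (divisors-unique m)
      (Unique.map⁺ (*-cancelˡ-≡ _ _ p) (divisors-unique M))
      λ { (v∈ , v∈′) → let w , _ , v≡ = ∈-map⁻ (p *_) v∈′ in
          p∤m (∣-trans (subst (p ∣_) (sym v≡) (m∣m*n w)) (∈-divisors⁻ m v∈)) }
    to : ∀ {z} → z ∈ divisors (p * M) → z ∈ divisors m ++ map (p *_) (divisors M)
    to {z} z∈ with p ∣? z
    ... | no p∤z = ∈-++⁺ˡ (∈-divisors 1≤m (coprime-^-divisor (suc e) (∤⇒coprime p∤z)
            (subst (z ∣_) (sym (*-assoc p (p ^ e) m)) (∈-divisors⁻ (p * M) z∈))))
    ... | yes (divides w z≡) with refl ← trans z≡ (*-comm w p) =
            ∈-++⁺ʳ (divisors m) (∈-map⁺ (p *_) (∈-divisors 1≤M (*-cancelˡ-∣ p (∈-divisors⁻ (p * M) z∈))))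
    from : ∀ {z} → z ∈ divisors m ++ map (p *_) (divisors M) → z ∈ divisors (p * M)
    from {z} z∈ with ∈-++⁻ (divisors m) z∈
    ... | inj₁ z∈m = ∈-divisors 1≤pM (∣n⇒∣m*n p (∣n⇒∣m*n (p ^ e) (∈-divisors⁻ m z∈m)))
    ... | inj₂ z∈p with w , w∈ , refl ← ∈-map⁻ (p *_) z∈p =
            ∈-divisors 1≤pM (*-monoʳ-∣ p (∈-divisors⁻ M w∈))

  -- Multiplicativity of σ for one prime power at a time, which is how `factorisation` takes a
  -- number apart.
  σ-^-* : ∀ {m} e → 1 ≤ m → ¬ p ∣ m → σ (p ^ e * m) ≡ geom p e * σ m
  σ-^-* {m} zero    1≤m p∤m = trans (cong σ (*-identityˡ m)) (sym (*-identityˡ (σ m)))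
  σ-^-* {m} (suc e) 1≤m p∤m = begin
    σ (p ^ suc e * m)              ≡⟨ cong σ (*-assoc p (p ^ e) m) ⟩
    σ (p * (p ^ e * m))            ≡⟨ σ-*-prime e 1≤m p∤m ⟩
    σ m + p * σ (p ^ e * m)        ≡⟨ cong (λ s → σ m + p * s) (σ-^-* e 1≤m p∤m) ⟩
    σ m + p * (geom p e * σ m)     ≡⟨ cong (σ m +_) (*-assoc p (geom p e) (σ m)) ⟨
    geom p (suc e) * σ m           ∎
    where open ≡-Reasoning

  split : ∀ m → Acc _<_ m → 1 ≤ m → ∃₂ λ e m′ → m ≡ p ^ e * m′ × ¬ p ∣ m′ × 1 ≤ m′
  split m (acc rec) 1≤m with p ∣? m
  ... | no p∤m = 0 , m , sym (*-identityˡ m) , p∤m , 1≤m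
  ... | yes p∣m =
    let q≢0 = quotient≢0 p∣m {{>-nonZero 1≤m}}
        e , m′ , eq , p∤m′ , 1≤m′ =
          split (quotient p∣m) (rec (quotient-< p∣m {{prime⇒nonTrivial p-prime}} {{>-nonZero 1≤m}}))
            (>-nonZero⁻¹ _ {{q≢0}})
    in suc e , m′ ,
       trans (m∣n⇒n≡m*quotient p∣m) (trans (cong (p *_) eq) (sym (*-assoc p (p ^ e) m′))) , p∤m′ , 1≤m′

-- Junk value 1 when n ≤ 1.
primeDivisor : ℕ → ℕ
primeDivisor zero      = 1
primeDivisor n@(suc _) with factors (factorise n)
... | []    = 1
... | p ∷ _ = p

primeDivisor-correct : ∀ {n} → 2 ≤ n → Prime (primeDivisor n) × primeDivisor n ∣ n
primeDivisor-correct {n@(suc _)} 2≤n with factorise n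
... | record { factors = [] ; isFactorisation = n≡1 } = contradiction (subst (2 ≤_) n≡1 2≤n) λ { (s≤s ()) }
... | record { factors = p ∷ ps ; isFactorisation = n≡ ; factorsPrime = p-prime ∷ _ } =
  p-prime , divides (product ps) (trans n≡ (*-comm p (product ps)))

-- The list `ps` is prescribed so that its order and length carry over to `L` along
-- `map base L ≡ ps`. Each prime is split off with its full power; completeness of `ps` forces the
-- final cofactor to be 1.
factorisation : ∀ ps m → 1 ≤ m → Unique ps → All Prime ps → All (_∣ m) ps →
  (∀ {q} → Prime q → q ∣ m → q ∈ ps) →
  ∃ λ L → map base L ≡ ps × All (λ x → 1 ≤ proj₂ x) L × ∏ power L ≡ m × ∏ sigma L ≡ σ m
factorisation [] m 1≤m [] [] [] complete with m ≟ 1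
... | yes refl = [] , refl , [] , refl , refl
... | no  m≢1  = contradiction (complete (proj₁ p) (proj₂ p)) λ ()
  where
  p = primeDivisor-correct (≤∧≢⇒< 1≤m (m≢1 ∘ sym))
factorisation (p ∷ ps) m 1≤m (p∉ ∷ uniq) (p-prime ∷ primes) (p∣m ∷ ps∣m) complete
  with split p-prime m (<-wellFounded m) 1≤m
... | zero , m′ , refl , p∤m′ , _ = contradiction (subst (p ∣_) (*-identityˡ m′) p∣m) p∤m′
... | e@(suc _) , m′ , refl , p∤m′ , 1≤m′ =
  let L , bases , exps , value , sig = factorisation ps m′ 1≤m′ uniq primes
        (All.tabulate λ q∈ → divides-m′ q∈) complete′
  in (p , e) ∷ L , cong (p ∷_) bases , s≤s z≤n ∷ exps , cong (p ^ e *_) value ,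
     trans (cong (geom p e *_) sig) (sym (σ-^-* p-prime e 1≤m′ p∤m′))
  where
  divides-m′ : ∀ {q} → q ∈ ps → q ∣ m′
  divides-m′ {q} q∈ with euclidsLemma (p ^ e) m′ (All.lookup primes q∈) (All.lookup ps∣m q∈)
  ... | inj₂ q∣m′ = q∣m′
  ... | inj₁ q∣p^e = contradiction (sym (prime∣^⇒≡ p-prime e (All.lookup primes q∈) q∣p^e)) (All.lookup p∉ q∈)
  complete′ : ∀ {q} → Prime q → q ∣ m′ → q ∈ ps
  complete′ q-prime q∣m′ with complete q-prime (∣n⇒∣m*n (p ^ e) q∣m′)
  ... | here refl = contradiction q∣m′ p∤m′
  ... | there q∈  = q∈

-- Bounding the prime powers

-- For x = (p , e), `top x` is p ^ (e + 1), so that σ (p ^ e) / p ^ e = (1 - 1 / top x) / (1 - 1 /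
-- p).
base-1 top : Power → ℕ
base-1 = pred ∘ base
top x = base x * power x

record OddPower (x : Power) : Set where
  constructor oddPower
  field
    base≥3       : 3 ≤ base x
    base-odd     : ¬ 2 ∣ base x
    exponent≥1   : 1 ≤ proj₂ x
open OddPower

Sorted : List Power → Set
Sorted = AllPairs (_<_ on base)

AllPairs-─ : ∀ {A : Set} {R : A → A → Set} {x xs} (i : x ∈ xs) → AllPairs R xs → AllPairs R (xs ─ i)
AllPairs-─ (here refl) (_ ∷ rs) = rs
AllPairs-─ (there i)   (r ∷ rs) = All.─⁺ i r ∷ AllPairs-─ i rs

-- The geometric series for p = q + 1, with the 1 moved to the left to avoid truncated subtraction.
geom-*-pred : ∀ q e → suc (geom (suc q) e * q) ≡ suc q * suc q ^ e
geom-*-pred q zero    = base-case q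
  where
  base-case : ∀ q → suc (1 * q) ≡ suc q * 1
  base-case = solve-∀
geom-*-pred q (suc e) = trans (step q (geom (suc q) e)) (cong (suc q *_) (geom-*-pred q e))
  where
  step : ∀ q g → suc ((1 + suc q * g) * q) ≡ suc q * suc (g * q)
  step = solve-∀

sigma-*-base-1 : ∀ {x} → OddPower x → sigma x * base-1 x ≡ pred (top x)
sigma-*-base-1 {suc q , e} _ = cong pred (geom-*-pred q e)

sigma≤top : ∀ {x} → OddPower x → sigma x ≤ top x
sigma≤top {suc q@(suc _) , e} _ =
  ≤-trans (m≤m*n (geom (suc q) e) q) (≤-trans (n≤1+n _) (≤-reflexive (geom-*-pred q e)))
sigma≤top {suc zero , _} (oddPower (s≤s ()) _ _)

power≤sigma : ∀ x → power x ≤ sigma x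
power≤sigma (p , zero)  = ≤-refl
power≤sigma (p , suc e) = m≤n⇒m≤1+n (*-monoʳ-≤ p (power≤sigma (p , e)))

power<sigma : ∀ {x} → OddPower x → power x < sigma x
power<sigma {p , suc e} _ = s≤s (*-monoʳ-≤ p (power≤sigma (p , e)))

power-positive : ∀ {x} → OddPower x → 0 < power x
power-positive {suc q , e} _ = m^n>0 (suc q) e

base-1-positive : ∀ {x} → OddPower x → 0 < base-1 x
base-1-positive ox = pred-mono-≤ (≤-trans (n≤1+n 2) (base≥3 ox))

even⊎odd : ∀ n → 2 ∣ n ⊎ 2 ∣ suc n
even⊎odd zero    = inj₁ (2 ∣0)
even⊎odd (suc n) with even⊎odd n
... | inj₁ 2∣n  = inj₂ (∣m∣n⇒∣m+n ∣-refl 2∣n)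
... | inj₂ 2∣1+n = inj₁ 2∣1+n

pred-odd : ∀ {n} → ¬ 2 ∣ n → 2 ∣ pred n
pred-odd {zero}  _     = 2 ∣0
pred-odd {suc n} 2∤1+n with even⊎odd n
... | inj₁ 2∣n   = 2∣n
... | inj₂ 2∣1+n = contradiction 2∣1+n 2∤1+n

odd-* : ∀ {m n} → ¬ 2 ∣ m → ¬ 2 ∣ n → ¬ 2 ∣ m * n
odd-* {m} {n} 2∤m 2∤n = [ 2∤m , 2∤n ]′ ∘ euclidsLemma m n prime[2]

odd-1 : ¬ 2 ∣ 1
odd-1 = >⇒∤ (s≤s (s≤s z≤n))

odd-^ : ∀ {m} e → ¬ 2 ∣ m → ¬ 2 ∣ m ^ e
odd-^ zero    2∤m = odd-1
odd-^ (suc e) 2∤m = odd-* 2∤m (odd-^ e 2∤m)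

odd-∏ : ∀ {A : Set} {f : A → ℕ} {xs} → All (λ x → ¬ 2 ∣ f x) xs → ¬ 2 ∣ ∏ f xs
odd-∏ []       = odd-1
odd-∏ (h ∷ hs) = odd-* h (odd-∏ hs)

odd-power : ∀ {x} → OddPower x → ¬ 2 ∣ power x
odd-power {_ , e} ox = odd-^ e (base-odd ox)

odd-top : ∀ {x} → OddPower x → ¬ 2 ∣ top x
odd-top ox = odd-* (base-odd ox) (odd-power ox)

-- Distinct bases exceeding q are at least q + 1, q + 2, …, so the product of
-- p / (p ∸ 1) telescopes to at most (q + length L) / q.
∏-base≤ : ∀ q {L} → Sorted L → All (λ x → q < base x) L →
  q * ∏ base L ≤ (q + length L) * ∏ base-1 L
∏-base≤ q []                []        = *-monoˡ-≤ 1 (m≤m+n q 0)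
∏-base≤ q {(suc y , _) ∷ L} (s ∷ ss) (s≤s q≤y ∷ _) = begin
  q * (suc y * B)              ≤⟨ *-monoʳ-≤ q (∏-base≤ (suc y) ss s) ⟩
  q * ((suc y + m) * C)        ≡⟨ lhs q y m C ⟩
  (q * y + q * suc m) * C      ≤⟨ *-monoˡ-≤ C (+-monoʳ-≤ (q * y) (*-monoˡ-≤ (suc m) q≤y)) ⟩
  (q * y + y * suc m) * C      ≡⟨ rhs q y m C ⟩
  (q + suc m) * (y * C)        ∎
  where
  open ≤-Reasoning
  B = ∏ base L
  C = ∏ base-1 L
  m = length L
  lhs : ∀ q y m C → q * ((suc y + m) * C) ≡ (q * y + q * suc m) * C
  lhs = solve-∀
  rhs : ∀ q y m C → (q * y + y * suc m) * C ≡ (q + suc m) * (y * C)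
  rhs = solve-∀

n*n≡n^2 : ∀ n → n * n ≡ n ^ 2
n*n≡n^2 n = cong (n *_) (sym (*-identityʳ n))

-- Let p = y + 1 be the least base and m ≤ r the number of bases. Then 1 + 1 / a ≤ b / a ≤ ∏ p / (p
-- - 1) ≤ 1 + m / y, which gives y ≤ r a.
first-base≤ : ∀ {a b} r x L → Sorted (x ∷ L) → All OddPower (x ∷ L) → length (x ∷ L) ≤ r →
  0 < a → a < b → b * ∏ base-1 (x ∷ L) ≤ a * ∏ base (x ∷ L) → base x ≤ suc r * a
first-base≤ r (zero , _) _ _ _ _ _ _ _ = z≤n
first-base≤ {a} {b} r (suc y , e) L sorted@(s ∷ _) odd len≤ 0<a a<b crossed = begin
  suc y        ≤⟨ s≤s y≤ar ⟩
  1 + r * a    ≤⟨ +-monoˡ-≤ (r * a) 0<a ⟩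
  a + r * a    ∎
  where
  open ≤-Reasoning
  xL = (suc y , e) ∷ L
  B = ∏ base xL
  C = ∏ base-1 xL
  m = length xL
  instance
    C≢0 : NonZero C
    C≢0 = >-nonZero (∏-positive base-1 (All.map base-1-positive odd))
  lhs : ∀ y a C → (y * a + y) * C ≡ y * (suc a * C)
  lhs = solve-∀
  rhs : ∀ y a m C → a * ((y + m) * C) ≡ (y * a + m * a) * C
  rhs = solve-∀
  y≤ar : y ≤ r * a
  y≤ar = ≤-trans (+-cancelˡ-≤ (y * a) _ _ (*-cancelʳ-≤ _ _ C (begin
    (y * a + y) * C         ≡⟨ lhs y a C ⟩
    y * (suc a * C)         ≤⟨ *-monoʳ-≤ y (*-monoˡ-≤ C a<b) ⟩
    y * (b * C)             ≤⟨ *-monoʳ-≤ y crossed ⟩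
    y * (a * B)             ≡⟨ x∙yz≈y∙xz y a B ⟩
    a * (y * B)             ≤⟨ *-monoʳ-≤ a (∏-base≤ y sorted (≤-refl ∷ All.map <⇒≤ s)) ⟩
    a * ((y + m) * C)       ≡⟨ rhs y a m C ⟩
    (y * a + m * a) * C     ∎))) (*-monoˡ-≤ a len≤)

-- `P` is the shortest nonempty initial block satisfying the inequality. If the first base p does
-- not suffice, then a p < b (p - 1), and the search continues with a p and b (p - 1) in place of a
-- and b. By `first-base≤` each base at most squares (r + 1) a, whence the exponent 2 ^ `length P`.
crossing : ∀ r L {a b} → Sorted L → All OddPower L → length L ≤ r → 0 < a → a < b →
  b * ∏ base-1 L ≤ a * ∏ base L →
  ∃₂ λ P R → L ≡ P ++ R × 1 ≤ length P × b * ∏ base-1 P ≤ a * ∏ base P ×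
    suc r * (a * ∏ base P) ≤ (suc r * a) ^ (2 ^ length P)
crossing r [] {a} {b} _ _ _ _ a<b crossed =
  contradiction (subst₂ _≤_ (*-identityʳ b) (*-identityʳ a) crossed) (<⇒≱ a<b)
crossing r (x@(p , _) ∷ L) {a} {b} sorted@(_ ∷ ss) odd@(ox ∷ os) len≤ 0<a a<b crossed
  with first-base≤ r x L sorted odd len≤ 0<a a<b crossed | b * pred p ≤? a * p
... | p≤ | yes done = x ∷ [] , L , refl , s≤s z≤n ,
      subst₂ _≤_ (cong (b *_) (sym (*-identityʳ _))) (cong (a *_) (sym (*-identityʳ _))) done ,
      (begin
        suc r * (a * (p * 1))   ≡⟨ reassoc r a p ⟩
        suc r * a * p           ≤⟨ *-monoʳ-≤ (suc r * a) p≤ ⟩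
        suc r * a * (suc r * a) ≡⟨ n*n≡n^2 (suc r * a) ⟩
        (suc r * a) ^ 2         ∎)
      where
      open ≤-Reasoning
      reassoc : ∀ r a p → suc r * (a * (p * 1)) ≡ suc r * a * p
      reassoc = solve-∀
... | p≤ | no below
      with crossing r L ss os (≤-trans (n≤1+n _) len≤) (*-mono-≤ 0<a (≤-trans (s≤s z≤n) (base≥3 ox))) (≰⇒> below)
             (subst₂ _≤_ (sym (*-assoc b (pred p) _)) (sym (*-assoc a p _)) crossed)
...   | P , R , refl , 1≤P , crossed′ , bound = x ∷ P , R , refl , s≤s z≤n ,
      subst₂ _≤_ (*-assoc b (pred p) _) (*-assoc a p _) crossed′ ,
      (begin
        suc r * (a * (p * ∏ base P))              ≡⟨ cong (suc r *_) (*-assoc a p (∏ base P)) ⟨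
        suc r * (a * p * ∏ base P)                ≤⟨ bound ⟩
        (suc r * (a * p)) ^ (2 ^ length P)        ≤⟨ ^-monoˡ-≤ (2 ^ length P) square ⟩
        ((suc r * a) ^ 2) ^ (2 ^ length P)        ≡⟨ ^-*-assoc (suc r * a) 2 (2 ^ length P) ⟩
        (suc r * a) ^ (2 ^ suc (length P))        ∎)
      where
      open ≤-Reasoning
      square : suc r * (a * p) ≤ (suc r * a) ^ 2
      square = begin
        suc r * (a * p)         ≡⟨ *-assoc (suc r) a p ⟨
        suc r * a * p           ≤⟨ *-monoʳ-≤ (suc r * a) p≤ ⟩
        suc r * a * (suc r * a) ≡⟨ n*n≡n^2 (suc r * a) ⟩
        (suc r * a) ^ 2         ∎

-- ∏ (1 − 1 / f x) ≥ 1 − length xs / T, cleared of denominators.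
∏-pred≥ : ∀ {A : Set} (f : A → ℕ) T {xs} → All (λ x → T ≤ f x) xs →
  T * ∏ f xs ≤ T * ∏ (pred ∘ f) xs + length xs * ∏ f xs
∏-pred≥ f T [] = m≤m+n (T * 1) 0
∏-pred≥ f T {x ∷ xs} (T≤ ∷ Ts) = step (f x) T≤ (∏-pred≥ f T Ts)
  where
  open ≤-Reasoning
  m = length xs
  expand : ∀ T z X → T * (suc z * X) ≡ z * (T * X) + T * X
  expand = solve-∀
  collect : ∀ T z X Y m → z * (T * Y + m * X) + suc z * X + m * X ≡ T * (z * Y) + suc m * (suc z * X)
  collect = solve-∀
  step : ∀ z {X Y} → T ≤ z → T * X ≤ T * Y + m * X → T * (z * X) ≤ T * (pred z * Y) + suc m * (z * X)
  step zero    {X} {Y} T≤ _  rewrite n≤0⇒n≡0 T≤ = z≤n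
  step (suc z) {X} {Y} T≤ ih = begin
    T * (suc z * X)                            ≡⟨ expand T z X ⟩
    z * (T * X) + T * X                        ≤⟨ +-mono-≤ (*-monoʳ-≤ z ih) (*-monoˡ-≤ X T≤) ⟩
    z * (T * Y + m * X) + suc z * X            ≤⟨ m≤m+n _ (m * X) ⟩
    z * (T * Y + m * X) + suc z * X + m * X    ≡⟨ collect T z X Y m ⟩
    T * (z * Y) + suc m * (suc z * X)          ∎

even-∏ : ∀ {A : Set} {f : A → ℕ} {xs} → 1 ≤ length xs → All (λ x → 2 ∣ f x) xs → 2 ∣ ∏ f xs
even-∏ {f = f} {x ∷ xs} _ (2∣ ∷ _) = ∣m⇒∣m*n (∏ f xs) 2∣

∏-pred-top : ∀ {P} → All OddPower P → ∏ sigma P * ∏ base-1 P ≡ ∏ (pred ∘ top) P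
∏-pred-top []         = refl
∏-pred-top {x ∷ P} (ox ∷ os) = trans (interchange (sigma x) (∏ sigma P) (base-1 x) (∏ base-1 P))
  (cong₂ _*_ (sigma-*-base-1 ox) (∏-pred-top os))

module _ {a} b {P R} (0<a : 0 < a) (P≢[] : 1 ≤ length P)
  (oddP : All OddPower P) (oddR : All OddPower R)
  (crossed : b * ∏ base-1 P ≤ a * ∏ base P)
  (eq : a * ∏ sigma (P ++ R) ≡ b * ∏ power (P ++ R)) where

  private
    C D X Y Qp Qr Sr : ℕ
    C = ∏ base-1 P
    D = ∏ base P
    X = ∏ top P
    Y = ∏ (pred ∘ top) P
    Qp = ∏ power P
    Qr = ∏ power R
    Sr = ∏ sigma R

    instance
      a≢0 : NonZero a
      a≢0 = >-nonZero 0<a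
      Qp≢0 : NonZero Qp
      Qp≢0 = >-nonZero (∏-positive power (All.map power-positive oddP))
      Qr≢0 : NonZero Qr
      Qr≢0 = >-nonZero (∏-positive power (All.map power-positive oddR))

    X≡D*Qp : X ≡ D * Qp
    X≡D*Qp = ∏-* P

    -- This is `eq` multiplied by `C`, which turns the factors σ (p ^ e) of `P` into the p ^ (e + 1)
    -- - 1 collected in `Y`.
    eq′ : a * Y * Sr ≡ b * C * (Qp * Qr)
    eq′ = begin
      a * Y * Sr                       ≡⟨ cong (λ y → a * y * Sr) (∏-pred-top oddP) ⟨
      a * (∏ sigma P * C) * Sr         ≡⟨ lhs a (∏ sigma P) C Sr ⟩
      a * (∏ sigma P * Sr) * C         ≡⟨ cong (λ s → a * s * C) (∏-++ sigma P R) ⟨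
      a * ∏ sigma (P ++ R) * C         ≡⟨ cong (_* C) eq ⟩
      b * ∏ power (P ++ R) * C         ≡⟨ cong (λ s → b * s * C) (∏-++ power P R) ⟩
      b * (Qp * Qr) * C                ≡⟨ xy∙z≈xz∙y b (Qp * Qr) C ⟩
      b * C * (Qp * Qr)                ∎
      where
      open ≡-Reasoning
      lhs : ∀ a s c t → a * (s * c) * t ≡ a * (s * t) * c
      lhs = solve-∀

    -- Equality would give Y * Sr ≡ X * Qr, with an even left and an odd right side.
    crossed-strictly : b * C < a * D
    crossed-strictly = ≤∧≢⇒< crossed λ bC≡aD →
      odd-* (odd-∏ (All.map odd-top oddP)) (odd-∏ (All.map odd-power oddR))
        (subst (2 ∣_)
          (*-cancelˡ-≡ (Y * Sr) (X * Qr) a (begin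
            a * (Y * Sr)              ≡⟨ *-assoc a Y Sr ⟨
            a * Y * Sr                ≡⟨ eq′ ⟩
            b * C * (Qp * Qr)         ≡⟨ cong (_* (Qp * Qr)) bC≡aD ⟩
            a * D * (Qp * Qr)         ≡⟨ reassoc a D Qp Qr ⟩
            a * (D * Qp * Qr)         ≡⟨ cong (λ x → a * (x * Qr)) X≡D*Qp ⟨
            a * (X * Qr)              ∎))
          (∣m⇒∣m*n Sr (even-∏ P≢[] (All.map (pred-odd ∘ odd-top) oddP))))
      where
      open ≡-Reasoning
      reassoc : ∀ a d q s → a * d * (q * s) ≡ a * (d * q * s)
      reassoc = solve-∀

    -- Divided by a X = a D Qp, this reads ∏ (1 - 1 / top x) ≤ 1 - 1 / (a D) over `P`. The term 1 /
    -- (a D) comes from the strictness of the crossing, an inequality between integers.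
    gap : a * Y + Qp ≤ a * X
    gap = begin
      a * Y + Qp             ≤⟨ +-monoˡ-≤ Qp (*-cancelʳ-≤ (a * Y) (b * C * Qp) Qr (begin
        a * Y * Qr             ≤⟨ *-monoʳ-≤ (a * Y) (∏-mono-≤ (All.map (<⇒≤ ∘ power<sigma) oddR)) ⟩
        a * Y * Sr             ≡⟨ eq′ ⟩
        b * C * (Qp * Qr)      ≡⟨ *-assoc (b * C) Qp Qr ⟨
        b * C * Qp * Qr        ∎)) ⟩
      b * C * Qp + Qp        ≡⟨ +-comm (b * C * Qp) Qp ⟩
      suc (b * C) * Qp       ≤⟨ *-monoˡ-≤ Qp crossed-strictly ⟩
      a * D * Qp             ≡⟨ *-assoc a D Qp ⟩
      a * (D * Qp)           ≡⟨ cong (a *_) X≡D*Qp ⟨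
      a * X                  ∎
      where open ≤-Reasoning

  -- If every `top x` were at least T = m a D + 1, then `∏-pred≥` would give ∏ (1 - 1 / top x) ≥ 1 -
  -- m / T > 1 - 1 / (a D), against `gap`.
  small-top : Any (λ x → top x ≤ length P * (a * D)) P
  small-top with any? (λ x → top x ≤? length P * (a * D)) P
  ... | yes small = small
  ... | no ¬small = contradiction T≤ (<⇒≱ (n<1+n (m * (a * D))))
    where
    open ≤-Reasoning
    m = length P
    T = suc (m * (a * D))
    lhs : ∀ T a Y Q → T * (a * Y) + T * Q ≡ T * (a * Y + Q)
    lhs = solve-∀
    rhs : ∀ T a Y m D Q → a * (T * Y + m * (D * Q)) ≡ T * (a * Y) + m * (a * D) * Q
    rhs = solve-∀
    T≤ : T ≤ m * (a * D)
    T≤ = *-cancelʳ-≤ T (m * (a * D)) Qp (+-cancelˡ-≤ (T * (a * Y)) _ _ (begin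
      T * (a * Y) + T * Qp                   ≡⟨ lhs T a Y Qp ⟩
      T * (a * Y + Qp)                       ≤⟨ *-monoʳ-≤ T gap ⟩
      T * (a * X)                            ≡⟨ x∙yz≈y∙xz T a X ⟩
      a * (T * X)                            ≤⟨ *-monoʳ-≤ a (∏-pred≥ top T (All.map ≰⇒> (All.¬Any⇒All¬ P ¬small))) ⟩
      a * (T * Y + m * X)                    ≡⟨ cong (λ x → a * (T * Y + m * x)) X≡D*Qp ⟩
      a * (T * Y + m * (D * Qp))             ≡⟨ rhs T a Y m D Qp ⟩
      T * (a * Y) + m * (a * D) * Qp         ∎))

-- That is, σ (B) / B < ∏ p / (p - 1): the quotient of the two sides is ∏ (1 - 1 / top x).
∏-sigma<∏-base : ∀ {L} → All OddPower L → 1 ≤ length L →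
  ∏ sigma L * ∏ base-1 L < ∏ base L * ∏ power L
∏-sigma<∏-base {L} odd 1≤L = subst₂ _<_ (sym (∏-pred-top odd)) (∏-* L) (pred< odd 1≤L)
  where
  0<top : ∀ {x} → OddPower x → 0 < top x
  0<top ox = *-mono-≤ (≤-trans (s≤s z≤n) (base≥3 ox)) (power-positive ox)
  pred< : ∀ {L} → All OddPower L → 1 ≤ length L → ∏ (pred ∘ top) L < ∏ top L
  pred< {x ∷ L} (ox ∷ os) _ = ≤-<-trans
    (*-monoʳ-≤ (pred (top x)) (∏-mono-≤ (All.universal (λ y → pred[n]≤n {top y}) L)))
    (*-monoˡ-< (∏ top L) {{>-nonZero (∏-positive top (All.map 0<top os))}}
      (≤-reflexive (suc-pred (top x) {{>-nonZero (0<top ox)}})))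

∏-power<∏-sigma : ∀ {L} → All OddPower L → 1 ≤ length L → ∏ power L < ∏ sigma L
∏-power<∏-sigma {x ∷ L} (ox ∷ os) _ = <-≤-trans
  (*-monoˡ-< (∏ power L) {{>-nonZero (∏-positive power (All.map power-positive os))}} (power<sigma ox))
  (*-monoʳ-≤ (sigma x) (∏-mono-≤ (All.map (<⇒≤ ∘ power<sigma) os)))

-- Splitting off one of m + 1 prime powers replaces (r + 1) a by at most its
-- (1 + 2 ^ (m + 1))-th power.
boundExponent : ℕ → ℕ
boundExponent zero    = 1
boundExponent (suc m) = (1 + 2 ^ suc m) * boundExponent m

module _ {L a} b (odd : All OddPower L) (0<a : 0 < a) (L≢[] : 1 ≤ length L)
  (eq : a * ∏ sigma L ≡ b * ∏ power L) where

  private instance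
    power≢0 : NonZero (∏ power L)
    power≢0 = >-nonZero (∏-positive power (All.map power-positive odd))

  ratio>1 : a < b
  ratio>1 = *-cancelʳ-< (∏ power L) a b (subst (a * ∏ power L <_) eq
    (*-monoʳ-< a {{>-nonZero 0<a}} (∏-power<∏-sigma odd L≢[])))

  -- Since b / a = σ (B) / B is below ∏ p / (p - 1), the whole list satisfies the crossing
  -- inequality, so `crossing` can find a block in it.
  crosses : b * ∏ base-1 L ≤ a * ∏ base L
  crosses = *-cancelʳ-≤ _ _ (∏ power L) (begin
    b * ∏ base-1 L * ∏ power L    ≡⟨ xy∙z≈xz∙y b (∏ base-1 L) (∏ power L) ⟩
    b * ∏ power L * ∏ base-1 L    ≡⟨ cong (_* ∏ base-1 L) eq ⟨
    a * ∏ sigma L * ∏ base-1 L    ≡⟨ *-assoc a (∏ sigma L) (∏ base-1 L) ⟩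
    a * (∏ sigma L * ∏ base-1 L)  ≤⟨ *-monoʳ-≤ a (<⇒≤ (∏-sigma<∏-base odd L≢[])) ⟩
    a * (∏ base L * ∏ power L)    ≡⟨ *-assoc a (∏ base L) (∏ power L) ⟨
    a * ∏ base L * ∏ power L      ∎)
    where
    open ≤-Reasoning

-- Induction on the number of prime powers left. `crossing` and `small-top` provide an `x` with
-- bounded `top x`; moving `sigma x` into `a` and `power x` into `b` preserves the equation for the
-- remaining list. The bound `r` stays fixed throughout.
sigma-bound : ∀ r m {L a} b → length L ≡ m → m ≤ r → Sorted L → All OddPower L → 0 < a →
  a * ∏ sigma L ≡ b * ∏ power L →
  suc r * (a * ∏ sigma L) ≤ (suc r * a) ^ boundExponent m
sigma-bound r zero {[]} {a} _ _ _ _ _ _ _ = ≤-reflexive (unit r a)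
  where
  unit : ∀ r a → suc r * (a * 1) ≡ (suc r * a) * 1
  unit = solve-∀
sigma-bound r (suc m) {L} {a} b len m<r sorted odd 0<a eq
  with crossing r L sorted odd (≤-trans (≤-reflexive len) m<r) 0<a (ratio>1 b odd 0<a L≢[] eq) (crosses b odd 0<a L≢[] eq)
  where
  L≢[] : 1 ≤ length L
  L≢[] = subst (1 ≤_) (sym len) (s≤s z≤n)
... | P , R , refl , P≢[] , crossedP , bound
  with find (small-top b 0<a P≢[] (All.++⁻ˡ P odd) (All.++⁻ʳ P odd) crossedP eq)
... | x , x∈P , top≤ = begin
  suc r * (a * ∏ sigma (P ++ R))                      ≡⟨ cong (suc r *_) eqσ ⟩
  suc r * (a * sigma x * ∏ sigma L′)                  ≤⟨ sigma-bound r m (b * power x) len′ (<⇒≤ m<r) (AllPairs-─ i sorted) (All.─⁺ i odd) 0<a′ eq′ ⟩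
  (suc r * (a * sigma x)) ^ boundExponent m           ≤⟨ ^-monoˡ-≤ (boundExponent m) step ⟩
  (base′ ^ (1 + 2 ^ suc m)) ^ boundExponent m         ≡⟨ ^-*-assoc base′ (1 + 2 ^ suc m) (boundExponent m) ⟩
  base′ ^ boundExponent (suc m)                       ∎
  where
  open ≤-Reasoning
  base′ = suc r * a
  D = ∏ base P
  i : x ∈ P ++ R
  i = ∈-++⁺ˡ x∈P
  L′ = (P ++ R) ─ i
  ox = All.lookup odd i
  0<a′ : 0 < a * sigma x
  0<a′ = *-mono-≤ 0<a (≤-trans (s≤s z≤n) (power<sigma ox))
  len′ : length L′ ≡ m
  len′ = suc-injective (trans (sym (length-removeAt′ (P ++ R) (Any.index i))) len)
  eqσ : a * ∏ sigma (P ++ R) ≡ a * sigma x * ∏ sigma L′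
  eqσ = trans (cong (a *_) (∏-─ sigma i)) (sym (*-assoc a (sigma x) _))
  eq′ : a * sigma x * ∏ sigma L′ ≡ b * power x * ∏ power L′
  eq′ = trans (sym eqσ) (trans eq (trans (cong (b *_) (∏-─ power i)) (sym (*-assoc b (power x) _))))
  P≤1+m : length P ≤ suc m
  P≤1+m = subst (length P ≤_) len (length-++-≤ˡ P)
  instance
    base′≢0 : NonZero base′
    base′≢0 = >-nonZero (*-mono-≤ (s≤s {n = r} z≤n) 0<a)
  step : suc r * (a * sigma x) ≤ base′ ^ (1 + 2 ^ suc m)
  step = begin
    suc r * (a * sigma x)                  ≡⟨ *-assoc (suc r) a (sigma x) ⟨
    base′ * sigma x                        ≤⟨ *-monoʳ-≤ base′ (≤-trans (sigma≤top ox) top≤) ⟩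
    -- The factor `length P` from `small-top` is absorbed by the `suc r` on the left of the bound
    -- from `crossing`.
    base′ * (length P * (a * D))           ≤⟨ *-monoʳ-≤ base′ (*-monoˡ-≤ (a * D) (≤-trans P≤1+m (m≤n⇒m≤1+n m<r))) ⟩
    base′ * (suc r * (a * D))              ≤⟨ *-monoʳ-≤ base′ bound ⟩
    base′ * base′ ^ (2 ^ length P)         ≤⟨ *-monoʳ-≤ base′ (^-monoʳ-≤ base′ (^-monoʳ-≤ 2 P≤1+m)) ⟩
    base′ * base′ ^ (2 ^ suc m)            ∎

-- Counting

boundExponent-mono : ∀ {m n} → m ≤ n → boundExponent m ≤ boundExponent n
boundExponent-mono = mono ∘ ≤⇒≤′
  where
  mono : ∀ {m n} → m ≤′ n → boundExponent m ≤ boundExponent n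
  mono ≤′-refl     = ≤-refl
  mono (≤′-step {n} m≤n) = ≤-trans (mono m≤n) (m≤n*m (boundExponent n) (1 + 2 ^ suc n))

-- With r = t + 2 this is (r - 1) * boundExponent r < 2 ^ r². Passing to r + 1 costs a factor of at
-- most 2 * 2 ^ (2 r), exactly what the increase 2 r + 1 of the square pays for.
boundExponent< : ∀ t → suc t * boundExponent (2 + t) < 2 ^ ((2 + t) * (2 + t))
-- `boundExponent 2` is 15, just below 2 ^ 4.
boundExponent< zero    = ≤-refl
boundExponent< (suc t) = begin-strict
  (2 + t) * ((1 + 2 ^ (3 + t)) * F)            ≤⟨ *-mono-≤ (2+t≤ t) (*-monoˡ-≤ F 1+2^≤) ⟩
  2 * suc t * (2 ^ (4 + 2 * t) * F)            ≡⟨ regroup (suc t) (2 ^ (4 + 2 * t)) F ⟩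
  2 ^ (5 + 2 * t) * (suc t * F)                <⟨ *-monoʳ-< (2 ^ (5 + 2 * t)) {{m^n≢0 2 (5 + 2 * t)}} (boundExponent< t) ⟩
  2 ^ (5 + 2 * t) * 2 ^ ((2 + t) * (2 + t))    ≡⟨ ^-distribˡ-+-* 2 (5 + 2 * t) _ ⟨
  2 ^ (5 + 2 * t + (2 + t) * (2 + t))          ≡⟨ cong (2 ^_) (square t) ⟩
  2 ^ ((3 + t) * (3 + t))                      ∎
  where
  open ≤-Reasoning
  F = boundExponent (2 + t)
  square : ∀ t → 5 + 2 * t + (2 + t) * (2 + t) ≡ (3 + t) * (3 + t)
  square = solve-∀
  double : ∀ t → 2 + t + t ≡ 2 * suc t
  double = solve-∀
  2+t≤ : ∀ t → 2 + t ≤ 2 * suc t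
  2+t≤ t = ≤-trans (m≤m+n (2 + t) t) (≤-reflexive (double t))
  regroup : ∀ s p f → 2 * s * (p * f) ≡ 2 * p * (s * f)
  regroup = solve-∀
  1+2^≤ : 1 + 2 ^ (3 + t) ≤ 2 ^ (4 + 2 * t)
  1+2^≤ = ≤-trans (+-mono-≤ (m^n>0 2 (3 + t)) (≤-reflexive (sym (+-identityʳ (2 ^ (3 + t))))))
            (^-monoʳ-≤ 2 (+-monoʳ-≤ 4 (m≤m+n t (t + 0))))

^-cancelʳ-≤ : ∀ b {m n} → 1 < b → b ^ m ≤ b ^ n → m ≤ n
^-cancelʳ-≤ b 1<b h = ≮⇒≥ λ n<m → <⇒≱ (^-monoʳ-< b 1<b n<m) h

-- For r ≥ 2 we have r + 1 ≤ 3 ^ (r - 1), hence e ≤ (r - 1) * boundExponent r.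
exponent< : ∀ {r e} → 1 ≤ r → 3 ^ e ≤ suc r ^ boundExponent r → e < 2 ^ (r * r)
-- For r = 1 that estimate fails, but `boundExponent 1` is 3 and 2 ^ 3 < 3 ^ 2.
exponent< {suc zero} {e} _ h = ≰⇒> λ 2≤e →
  contradiction (≤-trans (^-monoʳ-≤ 3 2≤e) h) (<⇒≱ (≤-refl {9}))
exponent< {suc (suc t)} {e} _ h = ≤-<-trans
  (^-cancelʳ-≤ 3 (s≤s (s≤s z≤n)) (begin
    3 ^ e                                       ≤⟨ h ⟩
    (3 + t) ^ boundExponent (2 + t)             ≤⟨ ^-monoˡ-≤ (boundExponent (2 + t)) (3+t≤ t) ⟩
    (3 ^ suc t) ^ boundExponent (2 + t)         ≡⟨ ^-*-assoc 3 (suc t) (boundExponent (2 + t)) ⟩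
    3 ^ (suc t * boundExponent (2 + t))         ∎))
  (boundExponent< t)
  where
  open ≤-Reasoning
  3+t≤ : ∀ t → 3 + t ≤ 3 ^ suc t
  3+t≤ zero    = ≤-refl
  3+t≤ (suc t) = ≤-trans (+-mono-≤ (m^n>0 3 (suc t)) (3+t≤ t)) (+-monoʳ-≤ (3 ^ suc t) (m≤m+n (3 ^ suc t) _))

-- At most r distinct bases, all above r, have ∏ p / (p - 1) ≤ (r + r) / r = 2 by the telescoping
-- bound.
∏-sigma<2∏-power : ∀ {r L} → 1 ≤ r → Sorted L → All OddPower L → All (λ x → r < base x) L →
  length L ≤ r → 1 ≤ length L → ∏ sigma L < 2 * ∏ power L
∏-sigma<2∏-power {r} {L} 1≤r sorted odd large len≤ L≢[] = *-cancelʳ-< C _ _ (begin-strict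
  ∏ sigma L * C             <⟨ ∏-sigma<∏-base odd L≢[] ⟩
  ∏ base L * ∏ power L      ≤⟨ *-monoˡ-≤ (∏ power L) B≤2C ⟩
  2 * C * ∏ power L         ≡⟨ xy∙z≈xz∙y 2 C (∏ power L) ⟩
  2 * ∏ power L * C         ∎)
  where
  open ≤-Reasoning
  C = ∏ base-1 L
  double : ∀ r C → (r + r) * C ≡ r * (2 * C)
  double = solve-∀
  B≤2C : ∏ base L ≤ 2 * C
  B≤2C = *-cancelˡ-≤ r {{>-nonZero 1≤r}} (begin
    r * ∏ base L          ≤⟨ ∏-base≤ r sorted large ⟩
    (r + length L) * C    ≤⟨ *-monoˡ-≤ C (+-monoʳ-≤ r len≤) ⟩
    (r + r) * C           ≡⟨ double r C ⟩
    r * (2 * C)           ∎)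

prime∣∏⇒∈ : ∀ {p L} → Prime p → All (Prime ∘ base) L → p ∣ ∏ power L → ∃ λ e → (p , e) ∈ L
prime∣∏⇒∈ p-prime [] p∣ = contradiction (∣1⇒≡1 p∣) λ { refl → ¬prime[1] p-prime }
prime∣∏⇒∈ {L = (q , e) ∷ L} p-prime (q-prime ∷ primes) p∣ with euclidsLemma (q ^ e) _ p-prime p∣
... | inj₂ p∣L = let e′ , i = prime∣∏⇒∈ p-prime primes p∣L in e′ , there i
... | inj₁ p∣q with refl ← prime∣^⇒≡ q-prime e p-prime p∣q = e , here refl

numerator : ℕ → ℕ → ℕ
numerator a b = quotient (gcd[m,n]∣m a b)

-- In lowest terms a / b = Q / S has a numerator dividing Q, and the numerator
-- is not 1 since 1 < S / Q < 2.
numerator-correct : ∀ a b {S Q} → 0 < a → a * S ≡ b * Q → Q < S → S < 2 * Q →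
  2 ≤ numerator a b × numerator a b ∣ Q
numerator-correct a b {S} {Q} 0<a eq Q<S S<2Q =
  2≤c c c′ cS≡c′Q 0<c , coprime-divisor coprime (divides S (trans (sym cS≡c′Q) (*-comm c S)))
  where
  g = gcd a b
  c = numerator a b
  c′ = quotient (gcd[m,n]∣n a b)
  a≡ : a ≡ c * g
  a≡ = m∣n⇒n≡quotient*m (gcd[m,n]∣m a b)
  b≡ : b ≡ c′ * g
  b≡ = m∣n⇒n≡quotient*m (gcd[m,n]∣n a b)
  0<c : 0 < c
  0<c = >-nonZero⁻¹ c {{quotient≢0 (gcd[m,n]∣m a b) {{>-nonZero 0<a}}}}
  instance
    g≢0 : NonZero g
    g≢0 = ≢-nonZero (gcd[m,n]≢0 a b (inj₁ (>⇒≢ 0<a)))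
  coprime : Coprime c c′
  coprime {d} (d∣c , d∣c′) = ∣1⇒≡1 (*-cancelʳ-∣ g (subst (d * g ∣_) (sym (*-identityˡ g))
    (gcd-greatest (subst (d * g ∣_) (sym a≡) (*-monoˡ-∣ g d∣c)) (subst (d * g ∣_) (sym b≡) (*-monoˡ-∣ g d∣c′)))))
  cS≡c′Q : c * S ≡ c′ * Q
  cS≡c′Q = *-cancelʳ-≡ (c * S) (c′ * Q) g (begin
    c * S * g     ≡⟨ xy∙z≈xz∙y c S g ⟩
    c * g * S     ≡⟨ cong (_* S) a≡ ⟨
    a * S         ≡⟨ eq ⟩
    b * Q         ≡⟨ cong (_* Q) b≡ ⟩
    c′ * g * Q    ≡⟨ xy∙z≈xz∙y c′ g Q ⟩
    c′ * Q * g    ∎)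
    where open ≡-Reasoning
  2≤c : ∀ c c′ → c * S ≡ c′ * Q → 0 < c → 2 ≤ c
  2≤c (suc (suc _)) _ _ _ = s≤s (s≤s z≤n)
  2≤c 1 c′ h _ with c′ ≤? 1
  ... | yes c′≤1 = contradiction (subst₂ _≤_ (trans (sym h) (*-identityˡ S)) (*-identityˡ Q) (*-monoˡ-≤ Q c′≤1)) (<⇒≱ Q<S)
  ... | no  c′≰1 = contradiction (subst (2 * Q ≤_) (trans (sym h) (*-identityˡ S)) (*-monoˡ-≤ Q (≰⇒> c′≰1))) (<⇒≱ S<2Q)

-- Enumeration of n by sequences of exponents

Strategy : Set
Strategy = ℕ → ℕ → ℕ

-- The state (A , a) is a unitary divisor A of n with a = σ A; a strategy picks
-- the prime by whose full power A is extended, and all exponents below X are tried.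
candidates : ℕ → List Strategy → ℕ → ℕ → List ℕ
candidates X []       A a = A ∷ []
candidates X (f ∷ fs) A a =
  concatMap (λ e → candidates X fs (A * f A a ^ e) (a * geom (f A a) e)) (upTo X)

length-concatMap : ∀ {A B : Set} (f : A → List B) {c} → (∀ x → length (f x) ≡ c) →
  ∀ xs → length (concatMap f xs) ≡ length xs * c
length-concatMap f h []       = refl
length-concatMap f h (x ∷ xs) = trans (length-++ (f x)) (cong₂ _+_ (h x) (length-concatMap f h xs))

length-candidates : ∀ X fs A a → length (candidates X fs A a) ≡ X ^ length fs
length-candidates X []       A a = refl
length-candidates X (f ∷ fs) A a =
  trans (length-concatMap _ (λ e → length-candidates X fs (A * f A a ^ e) (a * geom (f A a) e)) (upTo X))
        (cong (_* X ^ length fs) (length-upTo X))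

-- A run of the enumeration that ends in `n`: membership among the candidates is shown by naming the
-- exponents one after another.
data Reachable (X : ℕ) : List Strategy → ℕ → ℕ → ℕ → Set where
  stop   : ∀ {A a} → Reachable X [] A a A
  extend : ∀ {f fs A a n} e → e < X →
    Reachable X fs (A * f A a ^ e) (a * geom (f A a) e) n → Reachable X (f ∷ fs) A a n

reachable⇒∈ : ∀ {X fs A a n} → Reachable X fs A a n → n ∈ candidates X fs A a
reachable⇒∈ stop = here refl
reachable⇒∈ (extend {f} {fs} {A} {a} e e<X reach) = ∈-concatMap⁺
  (λ e → candidates _ fs (A * f A a ^ e) (a * geom (f A a) e)) (lose (∈-upTo⁺ e<X) (reachable⇒∈ reach))

-- Exponent 0 leaves the state unchanged, so a strategy may propose a number that is useless for n.
skip : ∀ {X f fs A a n} → 0 < X → Reachable X fs A a n → Reachable X (f ∷ fs) A a n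
skip {A = A} {a} 0<X reach = extend 0 0<X
  (subst₂ (λ A′ a′ → Reachable _ _ A′ a′ _) (sym (*-identityʳ A)) (sym (*-identityʳ a)) reach)

stay : ∀ {X} fs {A a} → 0 < X → Reachable X fs A a A
stay []       0<X = stop
stay (f ∷ fs) 0<X = skip 0<X (stay fs 0<X)

sorted⇒distinct : ∀ {x L} (i : x ∈ L) → Sorted L → All (λ y → base y ≢ base x) (L ─ i)
sorted⇒distinct (here refl) (s ∷ _)  = All.map >⇒≢ s
sorted⇒distinct (there i)   (s ∷ ss) = <⇒≢ (All.lookup s i) ∷ sorted⇒distinct i ss

module Counting (k r X : ℕ) (1≤r : 1 ≤ r) (0<X : 0 < X) where

  -- `L` factors the part B of n still to be found and `a` stands for σ (A), so `equation` is σ (A)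
  -- σ (B) = k A B.
  record State (A a : ℕ) (L : List Power) : Set where
    field
      sorted    : Sorted L
      powers    : All OddPower L
      primes    : All (Prime ∘ base) L
      exponents : All (λ x → proj₂ x < X) L
      length≤   : length L ≤ r
      a-positive : 0 < a
      equation  : a * ∏ sigma L ≡ k * A * ∏ power L
  open State

  extract : ∀ {A a L x} (i : x ∈ L) → State A a L → State (A * power x) (a * sigma x) (L ─ i)
  extract {A} {a} {L} {x} i s = record
    { sorted     = AllPairs-─ i (sorted s)
    ; powers     = All.─⁺ i (powers s)
    ; primes     = All.─⁺ i (primes s)
    ; exponents  = All.─⁺ i (exponents s)
    ; length≤    = ≤-trans (≤-trans (n≤1+n _) (≤-reflexive (sym (length-removeAt′ L (Any.index i))))) (length≤ s)
    ; a-positive = *-mono-≤ (a-positive s) (≤-trans (s≤s z≤n) (power<sigma (All.lookup (powers s) i)))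
    ; equation   = begin
        a * sigma x * ∏ sigma (L ─ i)          ≡⟨ *-assoc a (sigma x) _ ⟩
        a * (sigma x * ∏ sigma (L ─ i))        ≡⟨ cong (a *_) (∏-─ sigma i) ⟨
        a * ∏ sigma L                          ≡⟨ equation s ⟩
        k * A * ∏ power L                      ≡⟨ cong (k * A *_) (∏-─ power i) ⟩
        k * A * (power x * ∏ power (L ─ i))    ≡⟨ reassoc k A (power x) _ ⟩
        k * (A * power x) * ∏ power (L ─ i)    ∎
    }
    where
    open ≡-Reasoning
    reassoc : ∀ k A p q → k * A * (p * q) ≡ k * (A * p) * q
    reassoc = solve-∀

  extend-extract : ∀ {f fs A a L e} (i : (f A a , e) ∈ L) → State A a L →
    Reachable X fs (A * f A a ^ e) (a * geom (f A a) e) (A * f A a ^ e * ∏ power (L ─ i)) →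
    Reachable X (f ∷ fs) A a (A * ∏ power L)
  extend-extract {f} {A = A} {a} {e = e} i s reach = extend e (All.lookup (exponents s) i)
    (subst (Reachable _ _ _ _) (trans (*-assoc A (f A a ^ e) _) (cong (A *_) (sym (∏-─ power i)))) reach)

  -- The fraction a / (k A) equals B / σ (B), yet it is computed without knowing B.
  largePrime : Strategy
  largePrime A a = primeDivisor (numerator a (k * A))

  -- Only primes above `r` are left, so `numerator-correct` yields a prime of `L` as long as `L` is
  -- nonempty. Strategies remaining after that take exponent 0.
  reachable-large : ∀ j {A a L} → State A a L → All (λ x → r < base x) L → length L ≤ j →
    Reachable X (replicate j largePrime) A a (A * ∏ power L)
  reachable-large j {A} {a} {[]} s _ _ =
    subst (Reachable _ _ _ _) (sym (*-identityʳ A)) (stay (replicate j largePrime) 0<X)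
  reachable-large (suc j) {A} {a} {L@(_ ∷ _)} s large (s≤s len≤) =
    let e , i = prime∣∏⇒∈ p-prime (primes s) (∣-trans p∣c (proj₂ c-correct))
    in extend-extract i s (reachable-large j (extract i s) (All.─⁺ i large)
         (≤-trans (≤-reflexive (suc-injective (sym (length-removeAt′ L (Any.index i))))) len≤))
    where
    c-correct = numerator-correct a (k * A) (a-positive s) (equation s)
      (∏-power<∏-sigma (powers s) (s≤s z≤n))
      (∏-sigma<2∏-power 1≤r (sorted s) (powers s) large (length≤ s) (s≤s z≤n))
    p-prime = proj₁ (primeDivisor-correct (proj₁ c-correct))
    p∣c = proj₂ (primeDivisor-correct (proj₁ c-correct))

  -- First q, q - 1, ..., 1 are proposed in turn, prime or not, and then `r` large primes.
  strategies : ℕ → List Strategy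
  strategies zero    = replicate r largePrime
  strategies (suc q) = (λ _ _ → suc q) ∷ strategies q

  length-strategies : ∀ q → length (strategies q) ≡ q + r
  length-strategies zero    = length-replicate r
  length-strategies (suc q) = cong suc (length-strategies q)

  ≤-or-large : ∀ {q p} → p ≢ suc q × (p ≤ suc q ⊎ r < p) → p ≤ q ⊎ r < p
  ≤-or-large (p≢ , inj₁ p≤) = inj₁ (s≤s⁻¹ (≤∧≢⇒< p≤ p≢))
  ≤-or-large (_  , inj₂ r<) = inj₂ r<

  -- Whether `suc q` is extracted from `L` or skipped as absent, afterwards every base is at most
  -- `q` or above `r`. At q = 0 only the large primes remain.
  reachable : ∀ q {A a L} → State A a L → All (λ x → base x ≤ q ⊎ r < base x) L →
    Reachable X (strategies q) A a (A * ∏ power L)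
  reachable zero s split = reachable-large r s
    (All.zipWith (λ { (_ , inj₂ r<) → r< ; (ox , inj₁ ≤0) → contradiction (≤-trans (base≥3 ox) ≤0) λ () }) (powers s , split))
    (length≤ s)
  reachable (suc q) {L = L} s split with any? (λ x → base x ≟ suc q) L
  ... | no absent = skip 0<X (reachable q s
          (All.zipWith ≤-or-large (All.¬Any⇒All¬ L absent , split)))
  ... | yes present with (_ , e) , i , refl ← find present =
          extend-extract i s (reachable q (extract i s)
            (All.zipWith ≤-or-large (sorted⇒distinct i (sorted s) , All.─⁺ i split)))

  allCandidates : List ℕ
  allCandidates = candidates X (strategies r) 1 1

  length-allCandidates : length allCandidates ≡ X ^ (r + r)
  length-allCandidates = trans (length-candidates X (strategies r) 1 1) (cong (X ^_) (length-strategies r))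

-- Odd k-perfect numbers are among the candidates

module _ {k r n} (1≤r : 1 ≤ r) (good : Good k r n) where

  private
    1≤n = proj₁ good

    isPrimeDivisor? = λ p → prime? p ×-dec (p ∣? n)

    -- This is the list whose length defines `ω n`, and it is increasing; hence the bound on
    -- `length L` and the sortedness of `L`.
    ps : List ℕ
    ps = filter isPrimeDivisor? (map suc (upTo n))

    ps-sorted : AllPairs _<_ ps
    ps-sorted = AllPairs.filter⁺ isPrimeDivisor? (AllPairs.map⁺ (AllPairs.applyUpTo⁺₁ id n (λ i<j _ → s≤s i<j)))

    ps-prime-divisors : All (λ p → Prime p × p ∣ n) ps
    ps-prime-divisors = All.all-filter isPrimeDivisor? (map suc (upTo n))

    2∤n : ¬ 2 ∣ n
    2∤n 2∣n = contradiction (trans (sym (n∣m⇒m%n≡0 n 2 2∣n)) (proj₁ (proj₂ good))) λ ()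

    odd-prime : ∀ {p} → Prime p × p ∣ n → 3 ≤ p × ¬ 2 ∣ p
    odd-prime {p} (p-prime , p∣n) =
      ≤∧≢⇒< (nonTrivial⇒n>1 p {{prime⇒nonTrivial p-prime}}) (λ { refl → 2∤n p∣n }) , λ 2∣p → 2∤n (∣-trans 2∣p p∣n)

    fact = factorisation ps n 1≤n (AllPairs.map <⇒≢ ps-sorted) (All.map proj₁ ps-prime-divisors)
      (All.map proj₂ ps-prime-divisors) (λ q-prime q∣n → ∈-filter⁺ isPrimeDivisor? (∈-range 1≤n q∣n) (q-prime , q∣n))

    L : List Power
    L = proj₁ fact
    bases : map base L ≡ ps
    bases = proj₁ (proj₂ fact)
    exponents≥1 : All (λ x → 1 ≤ proj₂ x) L
    exponents≥1 = proj₁ (proj₂ (proj₂ fact))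
    value : ∏ power L ≡ n
    value = proj₁ (proj₂ (proj₂ (proj₂ fact)))
    sigma-value : ∏ sigma L ≡ σ n
    sigma-value = proj₂ (proj₂ (proj₂ (proj₂ fact)))

    base-props : All ((λ p → Prime p × p ∣ n) ∘ base) L
    base-props = All.map⁻ (subst (All _) (sym bases) ps-prime-divisors)

    oddL : All OddPower L
    oddL = All.zipWith (λ { (b , e) → let b≥3 , b-odd = odd-prime b in oddPower b≥3 b-odd e }) (base-props , exponents≥1)

    sortedL : Sorted L
    sortedL = AllPairs.map⁻ (subst (AllPairs _<_) (sym bases) ps-sorted)

    len≤ : length L ≤ r
    len≤ = subst (_≤ r) (trans (cong length (sym bases)) (length-map base L)) (proj₂ (proj₂ (proj₂ good)))

    eq : 1 * ∏ sigma L ≡ k * ∏ power L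
    eq = trans (*-identityˡ _) (trans sigma-value (trans (proj₁ (proj₂ (proj₂ good))) (cong (k *_) (sym value))))

    -- 3 ^ e ≤ p ^ e ≤ n ≤ σ (n), and `sigma-bound` with a = 1 and b = k bounds σ (n) independently
    -- of k.
    exponent-bound : ∀ {x} → x ∈ L → proj₂ x < 2 ^ (r * r)
    exponent-bound {x@(p , e)} i = exponent< 1≤r (begin
      3 ^ e                                     ≤⟨ ^-monoˡ-≤ e (base≥3 (All.lookup oddL i)) ⟩
      power x                                   ≤⟨ m≤m*n (power x) (∏ power (L ─ i)) {{>-nonZero rest>0}} ⟩
      power x * ∏ power (L ─ i)                 ≡⟨ ∏-─ power i ⟨
      ∏ power L                                 ≤⟨ ∏-mono-≤ (All.universal power≤sigma L) ⟩
      ∏ sigma L                                 ≡⟨ *-identityˡ _ ⟨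
      1 * ∏ sigma L                             ≤⟨ m≤n*m (1 * ∏ sigma L) (suc r) ⟩
      suc r * (1 * ∏ sigma L)                   ≤⟨ sigma-bound r (length L) k refl len≤ sortedL oddL (s≤s z≤n) eq ⟩
      (suc r * 1) ^ boundExponent (length L)    ≡⟨ cong (_^ boundExponent (length L)) (*-identityʳ (suc r)) ⟩
      suc r ^ boundExponent (length L)          ≤⟨ ^-monoʳ-≤ (suc r) (boundExponent-mono len≤) ⟩
      suc r ^ boundExponent r                   ∎)
      where
      open ≤-Reasoning
      rest>0 : 0 < ∏ power (L ─ i)
      rest>0 = ∏-positive power (All.─⁺ i (All.map power-positive oddL))

  open Counting k r (2 ^ (r * r)) 1≤r (m^n>0 2 (r * r))

  good⇒candidate : n ∈ allCandidates
  good⇒candidate = subst (_∈ allCandidates) (trans (*-identityˡ _) value) (reachable⇒∈ (reachable r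
    (record
      { sorted     = sortedL
      ; powers     = oddL
      ; primes     = All.map proj₁ base-props
      ; exponents  = All.tabulate exponent-bound
      ; length≤    = len≤
      ; a-positive = s≤s z≤n
      ; equation   = trans eq (cong (_* ∏ power L) (sym (*-identityʳ k)))
      })
    -- For q = r the alternative between small and large bases holds for every number.
    (All.universal (λ x → ≤-<-connex (base x) r) L)))

-- Comparing the lengths of lists, and the final count

∈-─ : ∀ {A : Set} {x y : A} {xs} (i : x ∈ xs) → y ∈ xs → x ≢ y → y ∈ (xs ─ i)
∈-─ (here refl) (here refl) x≢y = contradiction refl x≢y
∈-─ (here refl) (there j)   x≢y = j
∈-─ (there i)   (here refl) x≢y = here refl
∈-─ (there i)   (there j)   x≢y = there (∈-─ i j x≢y)

-- Pigeonhole: delete the head of `xs` from `ys`; being distinct from it, the other entries of `xs`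
-- survive the deletion.
unique⊆⇒length≤ : ∀ {A : Set} {xs ys : List A} → Unique xs → xs ⊆ ys → length xs ≤ length ys
unique⊆⇒length≤ [] _ = z≤n
unique⊆⇒length≤ {ys = ys} (x∉ ∷ uniq) sub = subst (_ ≤_) (sym (length-removeAt′ ys (Any.index (sub (here refl)))))
  (s≤s (unique⊆⇒length≤ uniq λ y∈ → ∈-─ (sub (here refl)) (sub (there y∈)) (All.lookup x∉ y∈)))

-- The count is expressed by bounding every duplicate-free list of solutions, which includes
-- finiteness.
theorem1 : (k r : ℕ) → 2 ≤ k → 1 ≤ r → (ns : List ℕ) → Unique ns → All (Good k r) ns →
    length ns ≤ k * 4 ^ (r * r * r)
theorem1 k r 2≤k 1≤r ns uniq goods = begin
  length ns                   ≤⟨ unique⊆⇒length≤ uniq (λ n∈ → good⇒candidate 1≤r (All.lookup goods n∈)) ⟩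
  length allCandidates        ≡⟨ length-allCandidates ⟩
  (2 ^ (r * r)) ^ (r + r)     ≡⟨ ^-*-assoc 2 (r * r) (r + r) ⟩
  2 ^ (r * r * (r + r))       ≡⟨ cong (2 ^_) (double r) ⟩
  2 ^ (2 * (r * r * r))       ≡⟨ ^-*-assoc 2 2 (r * r * r) ⟨
  4 ^ (r * r * r)             ≤⟨ m≤n*m (4 ^ (r * r * r)) k {{>-nonZero (≤-trans (s≤s z≤n) 2≤k)}} ⟩
  k * 4 ^ (r * r * r)         ∎
  where
  open ≤-Reasoning
  open Counting k r (2 ^ (r * r)) 1≤r (m^n>0 2 (r * r))
  double : ∀ r → r * r * (r + r) ≡ 2 * (r * r * r)
  double = solve-∀
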